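{- Consider the one-parameter family $E: y^2=x^3-t^2x+t^4$ with parameter $t$. Then for every prime $p>3$ the (unnormalized) second moment of the family at $p$ is $$\sum_{t \bmod p} a_t(p)^2=p^2-p-p\left(\frac{ -3}{p}\right)-p\left(\frac{12}{p}\right)-\sum_{x \bmod p}\ \sum_{y \bmod p}\left(\frac{x^3-x}{p}\right)\left(\frac{y^3-y}{p}\right).$$
   Context: For an odd prime $p$, $\left(\frac{\cdot}{p}\right)$ denotes the Legendre symbol, with $\left(\frac{u}{p}\right)=0$ if $p\mid u$. For a family $y^2=f_t(x)$ with $f_t(x)$ a cubic polynomial in $x$ with integer coefficients depending polynomially on $t$, one sets $a_t(p):=p-\#\{(x,y)\in(\mathbb{Z}/p\mathbb{Z})^2: y^2\equiv f_t(x) \bmod p\}=-\sum_{x \bmod p}\left(\frac{f_t(x)}{p}\right)$. No condition is imposed on the specialization $t$: all residues $t \bmod p$ are included, also those for which the curve is singular. -}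

module Defs where

open import Data.Bool.Base using (if_then_else_)
open import Data.Fin.Base using (Fin; toℕ)
open import Data.Fin.Properties using (any?)
open import Data.Integer.Base using (ℤ; +_; _+_; _-_; _*_; _^_; 0ℤ; 1ℤ; -1ℤ)
open import Data.Integer.Divisibility.Signed using (_∣_; _∣?_)
open import Data.Integer.Properties using (+-*-semiring)
open import Data.List.Base using (allFin; cartesianProduct; filter; length)
open import Data.Nat.Base using (ℕ)
open import Data.Product.Base using (_,_)
open import Relation.Nullary.Decidable using (Dec; does)

open import Algebra.Properties.Semiring.Sum +-*-semiring public
  using (sum; sum-syntax)

infix 4 _≡_[mod_] _≡?_[mod_]

_≡_[mod_] : ℤ → ℤ → ℕ → Set
a ≡ b [mod p ] = + p ∣ a - b

_≡?_[mod_] : ∀ a b p → Dec (a ≡ b [mod p ])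
a ≡? b [mod p ] = + p ∣? a - b

-- The elements of Z/pZ are the i : Fin p; ⟦ i ⟧ is the least nonnegative
-- representative of the class.
⟦_⟧ : ∀ {p} → Fin p → ℤ
⟦ i ⟧ = + toℕ i

-- The Legendre symbol (u/p); meaningful only for odd primes p.
legendre : ℤ → ℕ → ℤ
legendre u p =
  if does (u ≡? 0ℤ [mod p ]) then 0ℤ
  else if does (any? λ (x : Fin p) → ⟦ x ⟧ ^ 2 ≡? u [mod p ]) then 1ℤ
  else -1ℤ

-- Number of (x , y) in (Z/pZ)² with y² ≡ f(x) mod p.  Independent of the choice
-- of representatives when f is a polynomial with integer coefficients.
#points : (ℤ → ℤ) → ℕ → ℕ
#points f p =
  length (filter (λ (x , y) → ⟦ y ⟧ ^ 2 ≡? f ⟦ x ⟧ [mod p ])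
                 (cartesianProduct (allFin p) (allFin p)))

-- For a family y² = f t x, the quantity a_t(p).
a : (ℤ → ℤ → ℤ) → ℤ → ℕ → ℤ
a f t p = + p - + #points (f t) p

secondMoment : (ℤ → ℤ → ℤ) → ℕ → ℤ
secondMoment f p = ∑[ t < p ] (a f ⟦ t ⟧ p ^ 2)

-- The right-hand side of y² = x³ - t²x + t⁴.
E : ℤ → ℤ → ℤ
E t x = x ^ 3 - t ^ 2 * x + t ^ 4

{-# OPTIONS --safe #-}
module Submission where

-- Write χ for the Legendre symbol, so that -a_t(p) = T(t) = Σ_x χ(x³ - t²x + t⁴).  For t ≠ 0 the
-- substitution x ↦ t x gives T(t) = χ(t) V(t) with V(t) = Σ_x χ(t + x³ - x), while T(0) = Σ_x χ(x³) = 0;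
-- hence Σ_t T(t)² = Σ_t V(t)² - V(0)², and V(0)² is the double sum of the statement.  Expanding
-- V(t)² and summing over t first, Σ_t χ(t + a) χ(t + b) = p [a = b] - 1 yields Σ_t V(t)² = p N - p²,
-- where N counts the solutions of x³ - x = y³ - y: those on the line x = y and those on the conic
-- x² + x y + y² = 1, less those on both, so that N = p + (p - χ(-3)) - (1 + χ(12)).

open import Defs
open import Data.Bool.Base using (Bool; true; false; if_then_else_)
open import Data.Empty using (⊥-elim)
open import Data.Fin.Base using (Fin; zero; suc; toℕ; fromℕ<; punchIn)
open import Data.Fin.Properties using (any?; toℕ<n; toℕ-fromℕ<; toℕ-injective; punchInᵢ≢i)
open import Data.Integer.Base
  using (ℤ; +_; -_; _+_; _-_; _*_; _^_; 0ℤ; 1ℤ; -1ℤ; ∣_∣; _≤_; +≤+; -≤+; _%ℕ_; _/ℕ_)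
open import Data.Integer.DivMod using (n%ℕd<d; a≡a%ℕn+[a/ℕn]*n)
open import Data.Integer.Divisibility.Signed
  using (_∣_; divides; ∣ᵤ⇒∣; ∣⇒∣ᵤ; ∣n⇒∣m*n; ∣m∣n⇒∣m+n)
import Data.Integer.Properties as ℤ
open import Data.Integer.Properties using (+-*-semiring)
open import Data.Integer.Solver using (module +-*-Solver)
open import Data.List.Base using (tabulate; map; filter; length; cartesianProduct; _++_)
open import Data.List.Properties using (filter-++; length-++; map-tabulate)
open import Data.Nat.Base as ℕ using (ℕ; _>_; NonZero)
import Data.Nat.Coprimality as Coprimality
import Data.Nat.Divisibility as ℕ
open import Data.Nat.GCD using (module Bézout)
open import Data.Nat.Primality using (Prime; prime⇒nonZero; euclidsLemma)
import Data.Nat.Properties as ℕ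
open import Data.Product.Base using (_×_; _,_; ∃; proj₁; proj₂)
open import Data.Sum.Base using (_⊎_; inj₁; inj₂; [_,_]′)
open import Function.Base using (_∘_; id)
open import Function.Bundles using (mk⇔)
open import Relation.Binary.PropositionalEquality
  using (_≡_; _≢_; refl; sym; trans; cong; cong₂; subst; module ≡-Reasoning)
open import Relation.Nullary using (¬_; yes; no; contradiction)
open import Relation.Nullary.Decidable using (Dec; does; map′; dec-true; dec-false; does-⇔)
open import Relation.Unary using (Decidable)

open import Algebra.Properties.Semiring.Sum +-*-semiring
  using (sum-remove; sum-cong-≗; sum-replicate-zero; ∑-distrib-+; ∑-comm; *-distribˡ-sum)
open import Algebra.Properties.AbelianGroup ℤ.+-0-abelianGroup using () renaming (∙-cancelˡ to +-cancelˡ)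
open +-*-Solver using (solve; _:=_; _:+_; _:-_; _:*_; _:^_; :-_; con)
open ≡-Reasoning

-- Counts of filtered lists as indicator sums, and finite sums of integers.

𝟙 : ∀ {A : Set} → Dec A → ℤ
𝟙 d = if does d then 1ℤ else 0ℤ

module _ {A : Set} {P : A → Set} (P? : Decidable P) where

  length-filter-tabulate : ∀ {n} (f : Fin n → A) →
    + length (filter P? (tabulate f)) ≡ ∑[ i < n ] 𝟙 (P? (f i))
  length-filter-tabulate {ℕ.zero}  f = refl
  length-filter-tabulate {ℕ.suc n} f with does (P? (f zero))
  ... | true  = cong (_+_ 1ℤ) (length-filter-tabulate (f ∘ suc))
  ... | false = trans (length-filter-tabulate (f ∘ suc)) (sym (ℤ.+-identityˡ _))

module _ {A B : Set} {P : A × B → Set} (P? : Decidable P) where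

  length-filter-cartesianProduct : ∀ {m n} (f : Fin m → A) (g : Fin n → B) →
    + length (filter P? (cartesianProduct (tabulate f) (tabulate g))) ≡
    ∑[ i < m ] ∑[ j < n ] 𝟙 (P? (f i , g j))
  length-filter-cartesianProduct {ℕ.zero}  f g = refl
  length-filter-cartesianProduct {ℕ.suc m} f g = begin
    + length (filter P? (map (f zero ,_) (tabulate g) ++ rest))
      ≡⟨ cong (λ l → + length l) (filter-++ P? (map (f zero ,_) (tabulate g)) rest) ⟩
    + length (filter P? (map (f zero ,_) (tabulate g)) ++ filter P? rest)
      ≡⟨ cong +_ (length-++ (filter P? (map (f zero ,_) (tabulate g)))) ⟩
    + (length (filter P? (map (f zero ,_) (tabulate g))) ℕ.+ length (filter P? rest))
      ≡⟨ ℤ.pos-+ (length (filter P? (map (f zero ,_) (tabulate g)))) (length (filter P? rest)) ⟩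
    + length (filter P? (map (f zero ,_) (tabulate g))) + + length (filter P? rest)
      ≡⟨ cong₂ _+_
           (trans (cong (λ l → + length (filter P? l)) (map-tabulate g (f zero ,_)))
                  (length-filter-tabulate P? (λ j → f zero , g j)))
           (length-filter-cartesianProduct (f ∘ suc) g) ⟩
    (∑[ i < ℕ.suc m ] ∑[ j < _ ] 𝟙 (P? (f i , g j))) ∎
    where rest = cartesianProduct (tabulate (f ∘ suc)) (tabulate g)

sum-single : ∀ {n} (f : Fin n → ℤ) i → (∀ j → j ≢ i → f j ≡ 0ℤ) → sum f ≡ f i
sum-single {ℕ.suc n} f i f≡0 = begin
  sum f                                     ≡⟨ sum-remove {i = i} f ⟩
  f i + (∑[ j < n ] f (punchIn i j))
    ≡⟨ cong (_+_ (f i)) (sum-cong-≗ λ j → f≡0 (punchIn i j) (punchInᵢ≢i i j)) ⟩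
  f i + (∑[ j < n ] 0ℤ)                     ≡⟨ cong (_+_ (f i)) (sum-replicate-zero n) ⟩
  f i + 0ℤ                                  ≡⟨ ℤ.+-identityʳ (f i) ⟩
  f i                                       ∎

sum-const : ∀ n c → ∑[ i < n ] c ≡ + n * c
sum-const ℕ.zero    c = refl
sum-const (ℕ.suc n) c = trans (cong (_+_ c) (sum-const n c)) (sym (ℤ.suc-* (+ n) c))

sum-nonPos : ∀ {n} (f : Fin n → ℤ) → (∀ i → f i ≤ 0ℤ) → sum f ≤ 0ℤ
sum-nonPos {ℕ.zero}  f f≤0 = +≤+ ℕ.z≤n
sum-nonPos {ℕ.suc n} f f≤0 = ℤ.+-mono-≤ (f≤0 zero) (sum-nonPos (f ∘ suc) (f≤0 ∘ suc))

-- Splitting off the `i`-th term leaves a nonpositive remainder, so 0 = `sum f` ≤ `f i`. This drives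
-- the multiplicativity of the Legendre symbol.
nonPos-sum≡0⇒≡0 : ∀ {n} (f : Fin n → ℤ) → (∀ i → f i ≤ 0ℤ) → sum f ≡ 0ℤ → ∀ i → f i ≡ 0ℤ
nonPos-sum≡0⇒≡0 {ℕ.suc n} f f≤0 Σf≡0 i = ℤ.≤-antisym (f≤0 i)
  (subst (_≤ f i) Σf≡0
    (subst (_≤ f i) (sym (sum-remove {i = i} f))
      (subst (λ z → f i + sum rest ≤ z) (ℤ.+-identityʳ (f i))
        (ℤ.+-monoʳ-≤ (f i) (sum-nonPos rest λ j → f≤0 (punchIn i j))))))
  where rest = λ j → f (punchIn i j)

-- Congruence arithmetic modulo `p`.

module Residues (p : ℕ) .{{_ : NonZero p}} where

  -- A record, so that a and b can be inferred from the type a ≈ b.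
  infix 4 _≈_ _≉_ _≈?_
  record _≈_ (a b : ℤ) : Set where
    constructor mod
    field unmod : a ≡ b [mod p ]
  open _≈_ public

  _≉_ : ℤ → ℤ → Set
  a ≉ b = ¬ (a ≈ b)

  _≈?_ : ∀ a b → Dec (a ≈ b)
  a ≈? b = map′ mod unmod (a ≡? b [mod p ])

  -- Reduces deriving one congruence from another to a polynomial identity with explicit cofactor
  -- `k`, which the ring solver can check. `combination` does the same for two hypotheses.
  multiple : ∀ k {a b c d} → c ≈ d → a - b ≡ k * (c - d) → a ≈ b
  multiple k (mod p∣c-d) eq = mod (subst (+ p ∣_) (sym eq) (∣n⇒∣m*n k p∣c-d))

  combination : ∀ k l {a b c d e f} → c ≈ d → e ≈ f →
                a - b ≡ k * (c - d) + l * (e - f) → a ≈ b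
  combination k l (mod p∣c-d) (mod p∣e-f) eq =
    mod (subst (+ p ∣_) (sym eq) (∣m∣n⇒∣m+n (∣n⇒∣m*n k p∣c-d) (∣n⇒∣m*n l p∣e-f)))

  ≈-reflexive : ∀ {a b} → a ≡ b → a ≈ b
  ≈-reflexive {a} refl = mod (divides 0ℤ (ℤ.+-inverseʳ a))

  ≈-refl : ∀ {a} → a ≈ a
  ≈-refl = ≈-reflexive refl

  ≈-sym : ∀ {a b} → a ≈ b → b ≈ a
  ≈-sym {a} {b} a≈b =
    multiple -1ℤ a≈b (solve 2 (λ a b → b :- a := con -1ℤ :* (a :- b)) refl a b)

  ≈-trans : ∀ {a b c} → a ≈ b → b ≈ c → a ≈ c
  ≈-trans {a} {b} {c} a≈b b≈c = combination 1ℤ 1ℤ a≈b b≈c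
    (solve 3 (λ a b c → a :- c := con 1ℤ :* (a :- b) :+ con 1ℤ :* (b :- c)) refl a b c)

  +-cong : ∀ {a b c d} → a ≈ b → c ≈ d → a + c ≈ b + d
  +-cong {a} {b} {c} {d} a≈b c≈d = combination 1ℤ 1ℤ a≈b c≈d
    (solve 4 (λ a b c d → a :+ c :- (b :+ d) := con 1ℤ :* (a :- b) :+ con 1ℤ :* (c :- d)) refl a b c d)

  *-cong : ∀ {a b c d} → a ≈ b → c ≈ d → a * c ≈ b * d
  *-cong {a} {b} {c} {d} a≈b c≈d = combination c b a≈b c≈d
    (solve 4 (λ a b c d → a :* c :- b :* d := c :* (a :- b) :+ b :* (c :- d)) refl a b c d)

  +-congˡ : ∀ k {a b} → a ≈ b → k + a ≈ k + b
  +-congˡ k = +-cong (≈-refl {k})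

  +-congʳ : ∀ k {a b} → a ≈ b → a + k ≈ b + k
  +-congʳ k a≈b = +-cong a≈b (≈-refl {k})

  *-congˡ : ∀ k {a b} → a ≈ b → k * a ≈ k * b
  *-congˡ k = *-cong (≈-refl {k})

  *-congʳ : ∀ k {a b} → a ≈ b → a * k ≈ b * k
  *-congʳ k a≈b = *-cong a≈b (≈-refl {k})

  neg-cong : ∀ {a b} → a ≈ b → - a ≈ - b
  neg-cong {a} {b} a≈b =
    multiple -1ℤ a≈b (solve 2 (λ a b → :- a :- :- b := con -1ℤ :* (a :- b)) refl a b)

  minus-cong : ∀ {a b c d} → a ≈ b → c ≈ d → a - c ≈ b - d
  minus-cong a≈b c≈d = +-cong a≈b (neg-cong c≈d)

  ^-cong : ∀ n {a b} → a ≈ b → a ^ n ≈ b ^ n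
  ^-cong ℕ.zero    a≈b = ≈-refl
  ^-cong (ℕ.suc n) a≈b = *-cong a≈b (^-cong n a≈b)

  -- Two representatives below `p` differ by less than `p` in absolute value, so a difference
  -- divisible by `p` must be zero.
  ⟦⟧-injective : ∀ {i j : Fin p} → ⟦ i ⟧ ≈ ⟦ j ⟧ → i ≡ j
  ⟦⟧-injective {i} {j} (mod p∣i-j) with ∣ ⟦ i ⟧ - ⟦ j ⟧ ∣ in eq
  ... | ℕ.zero  = toℕ-injective (ℤ.+-injective (ℤ.i-j≡0⇒i≡j _ _ (ℤ.∣i∣≡0⇒i≡0 eq)))
  ... | ℕ.suc n = contradiction (subst (p ℕ.∣_) eq (∣⇒∣ᵤ p∣i-j)) (ℕ.>⇒∤ (subst (ℕ._< p) eq
        (ℕ.≤-<-trans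
          (subst (λ z → ∣ z ∣ ℕ.≤ toℕ i ℕ.⊔ toℕ j) (sym (ℤ.m-n≡m⊖n (toℕ i) (toℕ j)))
            (ℤ.∣m⊝n∣≤m⊔n (toℕ i) (toℕ j)))
          (ℕ.⊔-pres-<m (toℕ<n i) (toℕ<n j)))))

  class : ℤ → Fin p
  class a = fromℕ< (n%ℕd<d a p)

  ⟦class⟧ : ∀ a → ⟦ class a ⟧ ≈ a
  ⟦class⟧ a = ≈-sym (mod (divides (a /ℕ p) (begin
    a - ⟦ class a ⟧                              ≡⟨ cong (λ n → a - + n) (toℕ-fromℕ< (n%ℕd<d a p)) ⟩
    a - + (a %ℕ p)                                 ≡⟨ cong (_- + (a %ℕ p)) (a≡a%ℕn+[a/ℕn]*n a p) ⟩
    + (a %ℕ p) + (a /ℕ p) * + p - + (a %ℕ p)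
      ≡⟨ solve 2 (λ r q → r :+ q :- r := q) refl (+ (a %ℕ p)) ((a /ℕ p) * + p) ⟩
    (a /ℕ p) * + p                                 ∎)))

  -- δ, Σₚ, inv and χ are opaque so that unification compares their arguments
  -- instead of unfolding the underlying decision procedures.
  opaque
    δ : ℤ → ℤ → ℤ
    δ a b = 𝟙 (a ≈? b)

    δ-yes : ∀ {a b} → a ≈ b → δ a b ≡ 1ℤ
    δ-yes {a} {b} a≈b = cong (λ t → if t then 1ℤ else 0ℤ) (dec-true (a ≈? b) a≈b)

    δ-no : ∀ {a b} → a ≉ b → δ a b ≡ 0ℤ
    δ-no {a} {b} a≉b = cong (λ t → if t then 1ℤ else 0ℤ) (dec-false (a ≈? b) a≉b)

    δ-⇔ : ∀ {a b c d} → (a ≈ b → c ≈ d) → (c ≈ d → a ≈ b) → δ a b ≡ δ c d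
    δ-⇔ {a} {b} {c} {d} to from =
      cong (λ t → if t then 1ℤ else 0ℤ) (does-⇔ (mk⇔ to from) (a ≈? b) (c ≈? d))

  δ-cong : ∀ {a b c d} → a ≈ b → c ≈ d → δ a c ≡ δ b d
  δ-cong a≈b c≈d = δ-⇔ (λ a≈c → ≈-trans (≈-sym a≈b) (≈-trans a≈c c≈d))
                       (λ b≈d → ≈-trans a≈b (≈-trans b≈d (≈-sym c≈d)))

  δ-sym : ∀ a b → δ a b ≡ δ b a
  δ-sym a b = δ-⇔ ≈-sym ≈-sym

  -- Sums over Z/pZ.

  Periodic : (ℤ → ℤ) → Set
  Periodic F = ∀ {a b} → a ≈ b → F a ≡ F b

  opaque
    -- The summand is a function on all of ℤ, so that it can be a plain integer expression with
    -- arguments open to the ring solver. `Periodic` says that such a function descends to Z/pZ.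
    Σₚ : (ℤ → ℤ) → ℤ
    Σₚ F = ∑[ i < p ] F ⟦ i ⟧

    Σₚ-cong : ∀ {F G} → (∀ a → F a ≡ G a) → Σₚ F ≡ Σₚ G
    Σₚ-cong F≗G = sum-cong-≗ {p} λ i → F≗G ⟦ i ⟧

    Σₚ-+ : ∀ F G → Σₚ (λ a → F a + G a) ≡ Σₚ F + Σₚ G
    Σₚ-+ F G = ∑-distrib-+ {p} (F ∘ ⟦_⟧) (G ∘ ⟦_⟧)

    Σₚ-*ˡ : ∀ k F → Σₚ (λ a → k * F a) ≡ k * Σₚ F
    Σₚ-*ˡ k F = sym (*-distribˡ-sum {p} k (F ∘ ⟦_⟧))

    Σₚ-const : ∀ c → Σₚ (λ _ → c) ≡ + p * c
    Σₚ-const = sum-const p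

    Σₚ-comm : ∀ (F : ℤ → ℤ → ℤ) → Σₚ (λ a → Σₚ (F a)) ≡ Σₚ (λ b → Σₚ (λ a → F a b))
    Σₚ-comm F = ∑-comm {p} {p} (λ i j → F ⟦ i ⟧ ⟦ j ⟧)

    Σₚ-δ* : ∀ F → Periodic F → ∀ c → Σₚ (λ a → δ a c * F a) ≡ F c
    Σₚ-δ* F F-periodic c = begin
      Σₚ (λ a → δ a c * F a)
        ≡⟨ sum-single {p} (λ i → δ ⟦ i ⟧ c * F ⟦ i ⟧) r (λ j j≢r → cong (_* F ⟦ j ⟧) (δ-no (λ j≈c → j≢r (⟦⟧-injective (≈-trans j≈c (≈-sym (⟦class⟧ c))))))) ⟩
      δ ⟦ r ⟧ c * F ⟦ r ⟧       ≡⟨ cong₂ _*_ (δ-yes (⟦class⟧ c)) (F-periodic (⟦class⟧ c)) ⟩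
      1ℤ * F c                  ≡⟨ ℤ.*-identityˡ (F c) ⟩
      F c                       ∎
      where
      r : Fin p
      r = class c

  opaque
    unfolding Σₚ

    nonPos-Σₚ≡0⇒≡0 : ∀ F → Periodic F → (∀ a → F a ≤ 0ℤ) → Σₚ F ≡ 0ℤ → ∀ a → F a ≡ 0ℤ
    nonPos-Σₚ≡0⇒≡0 F F-periodic F≤0 ΣF≡0 a = trans (F-periodic (≈-sym (⟦class⟧ a)))
      (nonPos-sum≡0⇒≡0 {p} (F ∘ ⟦_⟧) (F≤0 ∘ ⟦_⟧) ΣF≡0 (class a))

  Σₚ-neg : ∀ F → Σₚ (λ a → - F a) ≡ - Σₚ F
  Σₚ-neg F = begin
    Σₚ (λ a → - F a)        ≡⟨ Σₚ-cong (λ a → sym (ℤ.-1*i≡-i (F a))) ⟩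
    Σₚ (λ a → -1ℤ * F a)    ≡⟨ Σₚ-*ˡ -1ℤ F ⟩
    -1ℤ * Σₚ F              ≡⟨ ℤ.-1*i≡-i (Σₚ F) ⟩
    - Σₚ F                  ∎

  Σₚ-∸ : ∀ F G → Σₚ (λ a → F a - G a) ≡ Σₚ F - Σₚ G
  Σₚ-∸ F G = trans (Σₚ-+ F (-_ ∘ G)) (cong (_+_ (Σₚ F)) (Σₚ-neg G))

  Σₚ-* : ∀ F G → Σₚ F * Σₚ G ≡ Σₚ (λ a → Σₚ (λ b → F a * G b))
  Σₚ-* F G = begin
    Σₚ F * Σₚ G                        ≡⟨ ℤ.*-comm (Σₚ F) (Σₚ G) ⟩
    Σₚ G * Σₚ F                        ≡⟨ Σₚ-*ˡ (Σₚ G) F ⟨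
    Σₚ (λ a → Σₚ G * F a)              ≡⟨ Σₚ-cong (λ a → ℤ.*-comm (Σₚ G) (F a)) ⟩
    Σₚ (λ a → F a * Σₚ G)              ≡⟨ Σₚ-cong (λ a → Σₚ-*ˡ (F a) G) ⟨
    Σₚ (λ a → Σₚ (λ b → F a * G b))    ∎

  Σₚ-δ : ∀ c → Σₚ (λ a → δ a c) ≡ 1ℤ
  Σₚ-δ c = trans (Σₚ-cong (λ a → sym (ℤ.*-identityʳ (δ a c)))) (Σₚ-δ* (λ _ → 1ℤ) (λ _ → refl) c)

  -- Write `F (φ a)` as the sum over `b` of `δ b (φ a) * F b` and exchange the sums: each `F b` is
  -- then weighted by the size of the fibre of `φ` over `b`.
  Σₚ-fibres : ∀ F → Periodic F → ∀ (φ : ℤ → ℤ) →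
              Σₚ (F ∘ φ) ≡ Σₚ (λ b → Σₚ (λ a → δ b (φ a)) * F b)
  Σₚ-fibres F F-periodic φ = begin
    Σₚ (F ∘ φ)                                  ≡⟨ Σₚ-cong (λ a → Σₚ-δ* F F-periodic (φ a)) ⟨
    Σₚ (λ a → Σₚ (λ b → δ b (φ a) * F b))       ≡⟨ Σₚ-comm (λ a b → δ b (φ a) * F b) ⟩
    Σₚ (λ b → Σₚ (λ a → δ b (φ a) * F b))
      ≡⟨ Σₚ-cong (λ b → Σₚ-cong (λ a → ℤ.*-comm (δ b (φ a)) (F b))) ⟩
    Σₚ (λ b → Σₚ (λ a → F b * δ b (φ a)))       ≡⟨ Σₚ-cong (λ b → Σₚ-*ˡ (F b) (λ a → δ b (φ a))) ⟩
    Σₚ (λ b → F b * Σₚ (λ a → δ b (φ a)))       ≡⟨ Σₚ-cong (λ b → ℤ.*-comm (F b) (Σₚ (λ a → δ b (φ a)))) ⟩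
    Σₚ (λ b → Σₚ (λ a → δ b (φ a)) * F b)       ∎

  -- The two implications say that the fibre of `φ` over `b` is exactly the class of `ψ b`, so every
  -- weight in `Σₚ-fibres` is 1.
  Σₚ-reindex : ∀ F → Periodic F → ∀ (φ ψ : ℤ → ℤ) →
               (∀ {a b} → b ≈ φ a → a ≈ ψ b) → (∀ {a b} → a ≈ ψ b → b ≈ φ a) →
               Σₚ (F ∘ φ) ≡ Σₚ F
  Σₚ-reindex F F-periodic φ ψ to from = begin
    Σₚ (F ∘ φ)                                  ≡⟨ Σₚ-fibres F F-periodic φ ⟩
    Σₚ (λ b → Σₚ (λ a → δ b (φ a)) * F b)
      ≡⟨ Σₚ-cong (λ b → cong (_* F b) (trans (Σₚ-cong (λ a → δ-⇔ to from)) (Σₚ-δ (ψ b)))) ⟩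
    Σₚ (λ b → 1ℤ * F b)                         ≡⟨ Σₚ-cong (λ b → ℤ.*-identityˡ (F b)) ⟩
    Σₚ F                                        ∎

  Σₚ-affine : ∀ F → Periodic F → ∀ u v c → u * v ≈ 1ℤ → Σₚ (λ a → F (u * a + c)) ≡ Σₚ F
  Σₚ-affine F F-periodic u v c uv≈1 = Σₚ-reindex F F-periodic (λ a → u * a + c) (λ b → v * (b - c))
    (λ {a} {b} b≈ua+c → combination (- a) (- v) uv≈1 b≈ua+c
      (solve 5 (λ u v c a b → a :- v :* (b :- c) :=
         (:- a) :* (u :* v :- con 1ℤ) :+ (:- v) :* (b :- (u :* a :+ c))) refl u v c a b))
    (λ {a} {b} a≈v[b-c] → combination (c - b) (- u) uv≈1 a≈v[b-c]
      (solve 5 (λ u v c a b → b :- (u :* a :+ c) :=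
         (c :- b) :* (u :* v :- con 1ℤ) :+ (:- u) :* (a :- v :* (b :- c))) refl u v c a b))

  Σₚ-translate : ∀ F → Periodic F → ∀ c → Σₚ (λ a → F (a + c)) ≡ Σₚ F
  Σₚ-translate F F-periodic c =
    trans (Σₚ-cong (λ a → cong (λ b → F (b + c)) (sym (ℤ.*-identityˡ a))))
          (Σₚ-affine F F-periodic 1ℤ 1ℤ c ≈-refl)

-- The field Z/pZ and its inverses.

module OddPrime (p : ℕ) (p-prime : Prime p) (p>2 : p > 2) where

  instance
    p-nonZero : NonZero p
    p-nonZero = prime⇒nonZero p-prime

  open Residues p

  pos≉0 : ∀ n .{{_ : NonZero n}} → n ℕ.< p → + n ≉ 0ℤ
  pos≉0 n n<p (mod p∣n) =
    ℕ.>⇒∤ n<p (subst (p ℕ.∣_) (ℕ.+-identityʳ n) (∣⇒∣ᵤ p∣n))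

  1≉0 : 1ℤ ≉ 0ℤ
  1≉0 = pos≉0 1 (ℕ.<-trans (ℕ.s≤s (ℕ.s≤s ℕ.z≤n)) p>2)

  2≉0 : + 2 ≉ 0ℤ
  2≉0 = pos≉0 2 p>2

  *≈0⇒≈0 : ∀ a b → a * b ≈ 0ℤ → a ≈ 0ℤ ⊎ b ≈ 0ℤ
  *≈0⇒≈0 a b (mod p∣ab) =
    [ inj₁ ∘ from-∣ a , inj₂ ∘ from-∣ b ]′ (euclidsLemma ∣ a ∣ ∣ b ∣ p-prime
      (subst (p ℕ.∣_) (trans (cong ∣_∣ (ℤ.+-identityʳ (a * b))) (ℤ.abs-* a b)) (∣⇒∣ᵤ p∣ab)))
    where
    from-∣ : ∀ c → p ℕ.∣ ∣ c ∣ → c ≈ 0ℤ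
    from-∣ c p∣c = mod (subst (+ p ∣_) (sym (ℤ.+-identityʳ c)) (∣ᵤ⇒∣ p∣c))

  *-≉0 : ∀ {a b} → a ≉ 0ℤ → b ≉ 0ℤ → a * b ≉ 0ℤ
  *-≉0 {a} {b} a≉0 b≉0 = [ a≉0 , b≉0 ]′ ∘ *≈0⇒≈0 a b

  ^-≉0 : ∀ n {a} → a ≉ 0ℤ → a ^ n ≉ 0ℤ
  ^-≉0 ℕ.zero    a≉0 = 1≉0
  ^-≉0 (ℕ.suc n) a≉0 = *-≉0 a≉0 (^-≉0 n a≉0)

  *-cancelˡ : ∀ {k a b} → k ≉ 0ℤ → k * a ≈ k * b → a ≈ b
  *-cancelˡ {k} {a} {b} k≉0 ka≈kb =
    [ ⊥-elim ∘ k≉0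
    , (λ a-b≈0 → multiple 1ℤ a-b≈0 (solve 2 (λ a b → a :- b := con 1ℤ :* (a :- b :- con 0ℤ)) refl a b))
    ]′ (*≈0⇒≈0 k (a - b) (multiple 1ℤ ka≈kb
          (solve 3 (λ k a b → k :* (a :- b) :- con 0ℤ := con 1ℤ :* (k :* a :- k :* b)) refl k a b)))

  -- The representative n of a nonzero class satisfies 0 < n < p, hence is coprime to the prime `p`.
  -- A Bézout coefficient inverts it, negated or not according to the sign of the identity.
  inverse : ∀ a → a ≉ 0ℤ → ∃ λ b → a * b ≈ 1ℤ
  inverse a a≉0 with toℕ (class a) in eq
  ... | ℕ.zero = contradiction (≈-trans (≈-sym (⟦class⟧ a)) (≈-reflexive (cong +_ eq))) a≉0
  ... | n@(ℕ.suc _) = let b , nb≈1 = bézout in b , ≈-trans (*-congʳ b a≈n) nb≈1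
    where
    a≈n : a ≈ + n
    a≈n = ≈-trans (≈-sym (⟦class⟧ a)) (≈-reflexive (cong +_ eq))

    bézout : ∃ λ b → + n * b ≈ 1ℤ
    bézout with Coprimality.coprime-Bézout (Coprimality.prime⇒coprime p-prime (subst (ℕ._< p) eq (toℕ<n (class a))))
    ... | Bézout.+- x y 1+yn≡xp = - + y , mod (divides (- + x) (begin
          + n * - + y - 1ℤ
            ≡⟨ solve 2 (λ y n → n :* (:- y) :- con 1ℤ := :- (con 1ℤ :+ y :* n)) refl (+ y) (+ n) ⟩
          - (1ℤ + + y * + n)      ≡⟨ cong (λ z → - (1ℤ + z)) (ℤ.pos-* y n) ⟨
          - + (1 ℕ.+ y ℕ.* n)     ≡⟨ cong (λ z → - + z) 1+yn≡xp ⟩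
          - + (x ℕ.* p)           ≡⟨ cong -_ (ℤ.pos-* x p) ⟩
          - (+ x * + p)           ≡⟨ ℤ.neg-distribˡ-* (+ x) (+ p) ⟩
          - + x * + p             ∎))
    ... | Bézout.-+ x y 1+xp≡yn = + y , mod (divides (+ x) (begin
          + n * + y - 1ℤ            ≡⟨ cong (_- 1ℤ) (trans (ℤ.*-comm (+ n) (+ y)) (sym (ℤ.pos-* y n))) ⟩
          + (y ℕ.* n) - 1ℤ          ≡⟨ cong (λ z → + z - 1ℤ) 1+xp≡yn ⟨
          1ℤ + + (x ℕ.* p) - 1ℤ     ≡⟨ cong (λ z → 1ℤ + z - 1ℤ) (ℤ.pos-* x p) ⟩
          1ℤ + + x * + p - 1ℤ       ≡⟨ solve 1 (λ z → con 1ℤ :+ z :- con 1ℤ := z) refl (+ x * + p) ⟩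
          + x * + p                 ∎))

  opaque
    inv : ℤ → ℤ
    inv a with a ≈? 0ℤ
    -- With the default 0 on the zero class, `inv` is an involution of all of Z/pZ, so a complete
    -- sum can be reindexed by it.
    ... | yes _   = 0ℤ
    ... | no a≉0 = proj₁ (inverse a a≉0)

    inv-0 : ∀ {a} → a ≈ 0ℤ → inv a ≡ 0ℤ
    inv-0 {a} a≈0 with a ≈? 0ℤ
    ... | yes _   = refl
    ... | no a≉0 = contradiction a≈0 a≉0

    *-inv : ∀ {a} → a ≉ 0ℤ → a * inv a ≈ 1ℤ
    *-inv {a} a≉0 with a ≈? 0ℤ
    ... | yes a≈0 = contradiction a≈0 a≉0
    ... | no a≉0′ = proj₂ (inverse a a≉0′)

  Σₚ-scale : ∀ F → Periodic F → ∀ {u} → u ≉ 0ℤ → Σₚ (λ a → F (u * a)) ≡ Σₚ F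
  Σₚ-scale F F-periodic {u} u≉0 =
    trans (Σₚ-cong (λ a → cong F (sym (ℤ.+-identityʳ (u * a)))))
          (Σₚ-affine F F-periodic u (inv u) 0ℤ (*-inv u≉0))

  -- Stated in the form that `Σₚ-reindex` takes for both of its implications when `φ` and `ψ` are
  -- `inv`.
  inv-flip : ∀ {a b} → b ≈ inv a → a ≈ inv b
  inv-flip {a} {b} b≈a⁻¹ with a ≈? 0ℤ
  ... | yes a≈0 = ≈-trans a≈0 (≈-reflexive (sym (inv-0 (≈-trans b≈a⁻¹ (≈-reflexive (inv-0 a≈0))))))
  ... | no a≉0  = *-cancelˡ b≉0 (≈-trans ba≈1 (≈-sym (*-inv b≉0)))
    where
    ba≈1 : b * a ≈ 1ℤ
    ba≈1 = ≈-trans (≈-reflexive (ℤ.*-comm b a)) (≈-trans (*-congˡ a b≈a⁻¹) (*-inv a≉0))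

    b≉0 : b ≉ 0ℤ
    b≉0 b≈0 = 1≉0 (≈-trans (≈-sym ba≈1) (*-congʳ a b≈0))

  -- The Legendre symbol: root counts and multiplicativity.

  root? : ∀ u → Dec (∃ λ (x : Fin p) → ⟦ x ⟧ ^ 2 ≡ u [mod p ])
  root? u = any? λ x → ⟦ x ⟧ ^ 2 ≡? u [mod p ]

  -- The nested tests of `legendre` as a function of their two truth values, so that `cong₂` can
  -- evaluate both at once.
  symbol : Bool → Bool → ℤ
  symbol isZero hasRoot = if isZero then 0ℤ else if hasRoot then 1ℤ else -1ℤ

  opaque
    χ : ℤ → ℤ
    χ u = legendre u p

    legendre≡χ : ∀ u → legendre u p ≡ χ u
    legendre≡χ u = refl

    χ-zero : ∀ {u} → u ≈ 0ℤ → χ u ≡ 0ℤ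
    χ-zero {u} (mod u≡0) =
      cong (λ b → symbol b (does (root? u))) (dec-true (u ≡? 0ℤ [mod p ]) u≡0)

    χ-residue : ∀ {u r} → r ≉ 0ℤ → u ≈ r ^ 2 → χ u ≡ 1ℤ
    χ-residue {u} {r} r≉0 u≈r² = cong₂ symbol
      (dec-false (u ≡? 0ℤ [mod p ]) (λ u≡0 → ^-≉0 2 r≉0 (≈-trans (≈-sym u≈r²) (mod u≡0))))
      (dec-true (root? u) (class r , unmod (≈-trans (^-cong 2 (⟦class⟧ r)) (≈-sym u≈r²))))

    χ-nonresidue : ∀ {u} → (∀ r → u ≉ r ^ 2) → χ u ≡ -1ℤ
    χ-nonresidue {u} u≉r² = cong₂ symbol
      -- `0ℤ ^ 2` computes to `0ℤ`, so the candidate root 0 already rules out `u ≈ 0ℤ`. The same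
      -- device gives nonvanishing of a nonresidue further on.
      (dec-false (u ≡? 0ℤ [mod p ]) (λ u≡0 → u≉r² 0ℤ (mod u≡0)))
      (dec-false (root? u) (λ (x , x²≡u) → u≉r² ⟦ x ⟧ (≈-sym (mod x²≡u))))

  data Residuosity (u : ℤ) : Set where
    zero       : u ≈ 0ℤ → Residuosity u
    residue    : ∀ r → r ≉ 0ℤ → u ≈ r ^ 2 → Residuosity u
    nonresidue : (∀ r → u ≉ r ^ 2) → Residuosity u

  residuosity : ∀ u → Residuosity u
  residuosity u with u ≈? 0ℤ
  ... | yes u≈0 = zero u≈0
  ... | no  u≉0 with root? u
  ...   | yes (x , x²≡u) = residue ⟦ x ⟧ x≉0 (≈-sym (mod x²≡u))
    where
    x≉0 : ⟦ x ⟧ ≉ 0ℤ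
    x≉0 x≈0 = u≉0 (≈-trans (≈-sym (mod x²≡u)) (^-cong 2 x≈0))
  ...   | no ∄root = nonresidue λ r u≈r² →
          ∄root (class r , unmod (≈-trans (^-cong 2 (⟦class⟧ r)) (≈-sym u≈r²)))

  ²≈0⇒≈0 : ∀ a → a ^ 2 ≈ 0ℤ → a ≈ 0ℤ
  ²≈0⇒≈0 a a²≈0 with a ≈? 0ℤ
  ... | yes a≈0 = a≈0
  ... | no  a≉0 = contradiction a²≈0 (^-≉0 2 a≉0)

  -- The number of square roots is 1, 2 or 0 in the three cases; in the residue case `r` and `- r`
  -- are distinct because `p` is odd. Periodicity of `χ`, its invariance under square factors and
  -- its vanishing sum are all deduced from this count.
  Σₚ-roots : ∀ u → Σₚ (λ y → δ (y ^ 2) u) ≡ 1ℤ + χ u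
  Σₚ-roots u with residuosity u
  ... | zero u≈0 = begin
    Σₚ (λ y → δ (y ^ 2) u)    ≡⟨ Σₚ-cong (λ y → δ-⇔
                                   (λ y²≈u → ²≈0⇒≈0 y (≈-trans y²≈u u≈0))
                                   (λ y≈0 → ≈-trans (^-cong 2 y≈0) (≈-sym u≈0))) ⟩
    Σₚ (λ y → δ y 0ℤ)         ≡⟨ Σₚ-δ 0ℤ ⟩
    1ℤ                        ≡⟨ cong (_+_ 1ℤ) (χ-zero u≈0) ⟨
    1ℤ + χ u                  ∎
  ... | residue r r≉0 u≈r² = begin
    Σₚ (λ y → δ (y ^ 2) u)             ≡⟨ Σₚ-cong two-roots ⟩
    Σₚ (λ y → δ y r + δ y (- r))       ≡⟨ Σₚ-+ (λ y → δ y r) (λ y → δ y (- r)) ⟩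
    Σₚ (λ y → δ y r) + Σₚ (λ y → δ y (- r))
                                       ≡⟨ cong₂ _+_ (Σₚ-δ r) (Σₚ-δ (- r)) ⟩
    1ℤ + 1ℤ                            ≡⟨ cong (_+_ 1ℤ) (χ-residue r≉0 u≈r²) ⟨
    1ℤ + χ u                           ∎
    where
    2r≉0 : + 2 * r ≉ 0ℤ
    2r≉0 = *-≉0 2≉0 r≉0

    two-roots : ∀ y → δ (y ^ 2) u ≡ δ y r + δ y (- r)
    two-roots y with y ≈? r | y ≈? - r
    ... | yes y≈r | yes y≈-r = contradiction
            (combination -1ℤ 1ℤ y≈r y≈-r
              (solve 2 (λ y r → con (+ 2) :* r :- con 0ℤ := con -1ℤ :* (y :- r) :+ con 1ℤ :* (y :- :- r)) refl y r)) 2r≉0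
    ... | yes y≈r | no y≉-r = trans
            (δ-yes (≈-trans (^-cong 2 y≈r) (≈-sym u≈r²))) (sym (cong₂ _+_ (δ-yes y≈r) (δ-no y≉-r)))
    ... | no y≉r | yes y≈-r = trans
            (δ-yes (≈-trans (^-cong 2 y≈-r) (≈-trans (≈-reflexive (solve 1 (λ r → (:- r) :^ 2 := r :^ 2) refl r)) (≈-sym u≈r²))))
            (sym (cong₂ _+_ (δ-no y≉r) (δ-yes y≈-r)))
    ... | no y≉r | no y≉-r = trans
            (δ-no λ y²≈u →
              [ (λ y-r≈0 → y≉r (multiple 1ℤ y-r≈0 (solve 2 (λ y r → y :- r := con 1ℤ :* (y :- r :- con 0ℤ)) refl y r)))
              , (λ y+r≈0 → y≉-r (multiple 1ℤ y+r≈0 (solve 2 (λ y r → y :- :- r := con 1ℤ :* (y :+ r :- con 0ℤ)) refl y r)))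
              ]′ (*≈0⇒≈0 (y - r) (y + r) (multiple 1ℤ (≈-trans y²≈u u≈r²)
                   (solve 2 (λ y r → (y :- r) :* (y :+ r) :- con 0ℤ := con 1ℤ :* (y :^ 2 :- r :^ 2)) refl y r))))
            (sym (cong₂ _+_ (δ-no y≉r) (δ-no y≉-r)))
  ... | nonresidue u≉r² = begin
    Σₚ (λ y → δ (y ^ 2) u)    ≡⟨ Σₚ-cong (λ y → δ-no (u≉r² y ∘ ≈-sym)) ⟩
    Σₚ (λ y → 0ℤ)             ≡⟨ Σₚ-const 0ℤ ⟩
    + p * 0ℤ                  ≡⟨ ℤ.*-zeroʳ (+ p) ⟩
    0ℤ                        ≡⟨ cong (_+_ 1ℤ) (χ-nonresidue u≉r²) ⟨
    1ℤ + χ u                  ∎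

  χ-cong : Periodic χ
  χ-cong {u} {v} u≈v = +-cancelˡ 1ℤ (χ u) (χ v) (begin
    1ℤ + χ u                  ≡⟨ Σₚ-roots u ⟨
    Σₚ (λ y → δ (y ^ 2) u)    ≡⟨ Σₚ-cong (λ y → δ-cong ≈-refl u≈v) ⟩
    Σₚ (λ y → δ (y ^ 2) v)    ≡⟨ Σₚ-roots v ⟩
    1ℤ + χ v                  ∎)

  -- The fibre of squaring over `s` has `1ℤ + χ s` elements.
  Σₚ-∘² : ∀ F → Periodic F → Σₚ (λ x → F (x ^ 2)) ≡ Σₚ F + Σₚ (λ s → χ s * F s)
  Σₚ-∘² F F-periodic = begin
    Σₚ (λ x → F (x ^ 2))                              ≡⟨ Σₚ-fibres F F-periodic (_^ 2) ⟩
    Σₚ (λ s → Σₚ (λ x → δ s (x ^ 2)) * F s)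
      ≡⟨ Σₚ-cong (λ s → cong (_* F s) (trans (Σₚ-cong (λ x → δ-sym s (x ^ 2))) (Σₚ-roots s))) ⟩
    Σₚ (λ s → (1ℤ + χ s) * F s)
      ≡⟨ Σₚ-cong (λ s → solve 2 (λ c f → (con 1ℤ :+ c) :* f := f :+ c :* f) refl (χ s) (F s)) ⟩
    Σₚ (λ s → F s + χ s * F s)                        ≡⟨ Σₚ-+ F (λ s → χ s * F s) ⟩
    Σₚ F + Σₚ (λ s → χ s * F s)                       ∎

  -- Substituting squares into the constant function 1 leaves its sum unchanged, so the correction
  -- term in `Σₚ-∘²`, which is the sum of `χ`, vanishes.
  Σₚ-χ : Σₚ χ ≡ 0ℤ
  Σₚ-χ = +-cancelˡ (Σₚ (λ _ → 1ℤ)) (Σₚ χ) 0ℤ (begin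
    Σₚ (λ _ → 1ℤ) + Σₚ χ
      ≡⟨ cong (_+_ (Σₚ (λ _ → 1ℤ))) (Σₚ-cong (λ s → ℤ.*-identityʳ (χ s))) ⟨
    Σₚ (λ _ → 1ℤ) + Σₚ (λ s → χ s * 1ℤ)     ≡⟨ Σₚ-∘² (λ _ → 1ℤ) (λ _ → refl) ⟨
    Σₚ (λ _ → 1ℤ)                           ≡⟨ ℤ.+-identityʳ _ ⟨
    Σₚ (λ _ → 1ℤ) + 0ℤ                      ∎)

  -- Multiplication by `r` carries the square roots of `u` bijectively to those of `r ^ 2 * u`, so
  -- the two root counts agree.
  χ-²* : ∀ {r} → r ≉ 0ℤ → ∀ u → χ (r ^ 2 * u) ≡ χ u
  χ-²* {r} r≉0 u = +-cancelˡ 1ℤ (χ (r ^ 2 * u)) (χ u) (begin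
    1ℤ + χ (r ^ 2 * u)                            ≡⟨ Σₚ-roots (r ^ 2 * u) ⟨
    Σₚ (λ y → δ (y ^ 2) (r ^ 2 * u))
      ≡⟨ Σₚ-scale (λ y → δ (y ^ 2) (r ^ 2 * u)) (λ y≈z → δ-cong (^-cong 2 y≈z) ≈-refl) r≉0 ⟨
    Σₚ (λ z → δ ((r * z) ^ 2) (r ^ 2 * u))   ≡⟨ Σₚ-cong (λ z → δ-⇔
                                                       (λ eq → *-cancelˡ (^-≉0 2 r≉0) (≈-trans (≈-reflexive (sym (square z))) eq))
                                                       (λ eq → ≈-trans (≈-reflexive (square z)) (*-congˡ (r ^ 2) eq))) ⟩
    Σₚ (λ z → δ (z ^ 2) u)                        ≡⟨ Σₚ-roots u ⟩
    1ℤ + χ u                                      ∎)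
    where
    square : ∀ z → (r * z) ^ 2 ≡ r ^ 2 * z ^ 2
    square = solve 2 (λ r z → (r :* z) :^ 2 := r :^ 2 :* z :^ 2) refl r

  χ≤1 : ∀ u → χ u ≤ 1ℤ
  χ≤1 u with residuosity u
  ... | zero u≈0           = subst (_≤ 1ℤ) (sym (χ-zero u≈0)) (+≤+ ℕ.z≤n)
  ... | residue r r≉0 u≈r² = ℤ.≤-reflexive (χ-residue r≉0 u≈r²)
  ... | nonresidue u≉r²    = subst (_≤ 1ℤ) (sym (χ-nonresidue u≉r²)) -≤+

  χ-* : ∀ u v → χ (u * v) ≡ χ u * χ v
  χ-* u v with residuosity u
  ... | zero u≈0 = begin
    χ (u * v)    ≡⟨ χ-zero (*-congʳ v u≈0) ⟩
    0ℤ * χ v     ≡⟨ cong (_* χ v) (χ-zero u≈0) ⟨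
    χ u * χ v    ∎
  ... | residue r r≉0 u≈r² = begin
    χ (u * v)        ≡⟨ χ-cong (*-congʳ v u≈r²) ⟩
    χ (r ^ 2 * v)    ≡⟨ χ-²* r≉0 v ⟩
    χ v              ≡⟨ ℤ.*-identityˡ (χ v) ⟨
    1ℤ * χ v         ≡⟨ cong (_* χ v) (χ-residue r≉0 u≈r²) ⟨
    χ u * χ v        ∎
  -- Every term χ (u w) + χ w is nonpositive, yet they sum to 0 over w.
  ... | nonresidue u≉r² = begin
    χ (u * v)          ≡⟨ solve 2 (λ a b → a := (a :+ b) :+ con -1ℤ :* b) refl (χ (u * v)) (χ v) ⟩
    F v + -1ℤ * χ v    ≡⟨ cong (_+ -1ℤ * χ v) (nonPos-Σₚ≡0⇒≡0 F F-periodic F≤0 ΣF≡0 v) ⟩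
    0ℤ + -1ℤ * χ v     ≡⟨ ℤ.+-identityˡ _ ⟩
    -1ℤ * χ v          ≡⟨ cong (_* χ v) (χ-nonresidue u≉r²) ⟨
    χ u * χ v          ∎
    where
    F : ℤ → ℤ
    F w = χ (u * w) + χ w

    F-periodic : Periodic F
    F-periodic w≈z = cong₂ _+_ (χ-cong (*-congˡ u w≈z)) (χ-cong w≈z)

    -- At a residue `w` the two terms cancel, by `χ-²*`; at a nonresidue, `χ w` is -1 and absorbs
    -- `χ (u * w)`, which is at most 1.
    F≤0 : ∀ w → F w ≤ 0ℤ
    F≤0 w with residuosity w
    ... | zero w≈0 = ℤ.≤-reflexive (cong₂ _+_
            (χ-zero (≈-trans (*-congˡ u w≈0) (≈-reflexive (ℤ.*-zeroʳ u)))) (χ-zero w≈0))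
    ... | residue r r≉0 w≈r² = ℤ.≤-reflexive (cong₂ _+_
            (trans (χ-cong (≈-trans (*-congˡ u w≈r²) (≈-reflexive (ℤ.*-comm u (r ^ 2)))))
                   (trans (χ-²* r≉0 u) (χ-nonresidue u≉r²)))
            (χ-residue r≉0 w≈r²))
    ... | nonresidue w≉r² = subst (λ z → χ (u * w) + z ≤ 0ℤ) (sym (χ-nonresidue w≉r²))
            (ℤ.+-monoˡ-≤ -1ℤ (χ≤1 (u * w)))

    ΣF≡0 : Σₚ F ≡ 0ℤ
    ΣF≡0 = trans (Σₚ-+ (λ w → χ (u * w)) χ)
      (cong₂ _+_ (trans (Σₚ-scale χ χ-cong (u≉r² 0ℤ)) Σₚ-χ) Σₚ-χ)

  -- Powers of the Legendre symbol, its correlations and quadratic character sums.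

  χ-square : ∀ u → χ u * χ u ≡ 1ℤ - δ u 0ℤ
  χ-square u with residuosity u
  ... | zero u≈0 = trans (cong₂ _*_ (χ-zero u≈0) (χ-zero u≈0)) (cong (_-_ 1ℤ) (sym (δ-yes u≈0)))
  ... | residue r r≉0 u≈r² = trans (cong₂ _*_ (χ-residue r≉0 u≈r²) (χ-residue r≉0 u≈r²))
          (cong (_-_ 1ℤ) (sym (δ-no λ u≈0 → ^-≉0 2 r≉0 (≈-trans (≈-sym u≈r²) u≈0))))
  ... | nonresidue u≉r² = trans (cong₂ _*_ (χ-nonresidue u≉r²) (χ-nonresidue u≉r²))
          (cong (_-_ 1ℤ) (sym (δ-no (u≉r² 0ℤ))))

  χ-1 : χ 1ℤ ≡ 1ℤ
  χ-1 = χ-residue 1≉0 ≈-refl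

  χ-³ : ∀ x → χ (x ^ 3) ≡ χ x
  χ-³ x with x ≈? 0ℤ
  ... | yes x≈0 = trans (χ-zero (^-cong 3 x≈0)) (sym (χ-zero x≈0))
  ... | no  x≉0 = trans (cong χ (solve 1 (λ x → x :^ 3 := x :^ 2 :* x) refl x)) (χ-²* x≉0 x)

  -- For t ≉ 0, t (t + c) = t² (1 + c / t), and 1 + c / t runs over all classes except 1.
  Σₚ-χχ-shift : ∀ {c} → c ≉ 0ℤ → Σₚ (λ t → χ t * χ (t + c)) ≡ -1ℤ
  Σₚ-χχ-shift {c} c≉0 = begin
    Σₚ (λ t → χ t * χ (t + c))                 ≡⟨ Σₚ-cong pointwise ⟩
    -- At `t ≈ 0ℤ` the default `inv t = 0` contributes `χ 1ℤ`, which is 1; the indicator removes it.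
    -- The remaining sum is then complete and vanishes.
    Σₚ (λ t → χ (c * inv t + 1ℤ) - δ t 0ℤ)     ≡⟨ Σₚ-∸ (λ t → χ (c * inv t + 1ℤ)) (λ t → δ t 0ℤ) ⟩
    Σₚ (λ t → χ (c * inv t + 1ℤ)) - Σₚ (λ t → δ t 0ℤ)
      ≡⟨ cong₂ _-_
           (trans (Σₚ-reindex (λ s → χ (c * s + 1ℤ)) (λ s≈r → χ-cong (+-congʳ 1ℤ (*-congˡ c s≈r))) inv inv inv-flip inv-flip)
           (trans (Σₚ-affine χ χ-cong c (inv c) 1ℤ (*-inv c≉0)) Σₚ-χ))
           (Σₚ-δ 0ℤ) ⟩
    -1ℤ                                        ∎
    where
    pointwise : ∀ t → χ t * χ (t + c) ≡ χ (c * inv t + 1ℤ) - δ t 0ℤ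
    pointwise t with t ≈? 0ℤ
    ... | yes t≈0 = begin
      χ t * χ (t + c)                ≡⟨ cong (_* χ (t + c)) (χ-zero t≈0) ⟩
      0ℤ
        ≡⟨ cong₂ _-_ (trans (cong χ (trans (cong (λ i → c * i + 1ℤ) (inv-0 t≈0)) (cong (_+ 1ℤ) (ℤ.*-zeroʳ c)))) χ-1) (δ-yes t≈0) ⟨
      χ (c * inv t + 1ℤ) - δ t 0ℤ    ∎
    ... | no t≉0 = begin
      χ t * χ (t + c)                ≡⟨ χ-* t (t + c) ⟨
      χ (t * (t + c))                ≡⟨ χ-cong (multiple (- (t * c)) (*-inv t≉0)
                                          (solve 3 (λ t c i → t :* (t :+ c) :- t :^ 2 :* (c :* i :+ con 1ℤ) :=
                                            (:- (t :* c)) :* (t :* i :- con 1ℤ)) refl t c (inv t))) ⟩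
      χ (t ^ 2 * (c * inv t + 1ℤ))   ≡⟨ χ-²* t≉0 _ ⟩
      χ (c * inv t + 1ℤ)             ≡⟨ ℤ.+-identityʳ _ ⟨
      χ (c * inv t + 1ℤ) - 0ℤ        ≡⟨ cong (_-_ (χ (c * inv t + 1ℤ))) (δ-no t≉0) ⟨
      χ (c * inv t + 1ℤ) - δ t 0ℤ    ∎

  -- On the diagonal, `χ` squared is 1 away from the single zero, giving p - 1. Otherwise
  -- translating by `a` leaves a correlation with nonzero shift `b - a`.
  Σₚ-χχ : ∀ a b → Σₚ (λ t → χ (t + a) * χ (t + b)) ≡ + p * δ a b - 1ℤ
  Σₚ-χχ a b with a ≈? b
  ... | yes a≈b = begin
    Σₚ (λ t → χ (t + a) * χ (t + b))    ≡⟨ Σₚ-cong (λ t → cong (_* χ (t + b)) (χ-cong (+-congˡ t a≈b))) ⟩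
    Σₚ (λ t → χ (t + b) * χ (t + b))
      ≡⟨ Σₚ-translate (λ t → χ t * χ t) (λ s≈t → cong₂ _*_ (χ-cong s≈t) (χ-cong s≈t)) b ⟩
    Σₚ (λ t → χ t * χ t)                ≡⟨ Σₚ-cong χ-square ⟩
    Σₚ (λ t → 1ℤ - δ t 0ℤ)              ≡⟨ Σₚ-∸ (λ _ → 1ℤ) (λ t → δ t 0ℤ) ⟩
    Σₚ (λ t → 1ℤ) - Σₚ (λ t → δ t 0ℤ)   ≡⟨ cong₂ _-_ (Σₚ-const 1ℤ) (Σₚ-δ 0ℤ) ⟩
    + p * 1ℤ - 1ℤ                       ≡⟨ cong (λ d → + p * d - 1ℤ) (δ-yes a≈b) ⟨
    + p * δ a b - 1ℤ                    ∎
  ... | no a≉b = begin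
    Σₚ (λ t → χ (t + a) * χ (t + b))    ≡⟨ Σₚ-cong (λ t → cong (λ s → χ (t + a) * χ s)
                                             (solve 3 (λ t a b → t :+ b := t :+ a :+ (b :- a)) refl t a b)) ⟩
    Σₚ (λ t → χ (t + a) * χ (t + a + (b - a)))
                                        ≡⟨ Σₚ-translate (λ t → χ t * χ (t + (b - a))) (λ s≈t → cong₂ _*_ (χ-cong s≈t) (χ-cong (+-congʳ (b - a) s≈t))) a ⟩
    Σₚ (λ t → χ t * χ (t + (b - a)))    ≡⟨ Σₚ-χχ-shift (λ b-a≈0 → a≉b (multiple -1ℤ b-a≈0
                                             (solve 2 (λ a b → a :- b := con -1ℤ :* (b :- a :- con 0ℤ)) refl a b))) ⟩
    -1ℤ                                 ≡⟨ cong (_- 1ℤ) (ℤ.*-zeroʳ (+ p)) ⟨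
    + p * 0ℤ - 1ℤ                       ≡⟨ cong (λ d → + p * d - 1ℤ) (δ-no a≉b) ⟨
    + p * δ a b - 1ℤ                    ∎

  -- Replacing `x ^ 2` by `s` with weight `1ℤ + χ s` splits the sum: the unweighted part is a
  -- complete sum of `χ`, hence 0, and the other is `χ n` times a correlation with shift m/n, which
  -- is nonzero.
  Σₚ-χ-quadratic : ∀ {m n} → m ≉ 0ℤ → n ≉ 0ℤ → Σₚ (λ x → χ (n * x ^ 2 + m)) ≡ - χ n
  Σₚ-χ-quadratic {m} {n} m≉0 n≉0 = begin
    Σₚ (λ x → χ (n * x ^ 2 + m))                ≡⟨ Σₚ-∘² F F-periodic ⟩
    Σₚ F + Σₚ (λ s → χ s * F s)
      ≡⟨ cong₂ _+_ (trans (Σₚ-affine χ χ-cong n (inv n) m (*-inv n≉0)) Σₚ-χ)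
                                                     (Σₚ-cong factor) ⟩
    0ℤ + Σₚ (λ s → χ n * (χ s * χ (s + c)))     ≡⟨ ℤ.+-identityˡ _ ⟩
    Σₚ (λ s → χ n * (χ s * χ (s + c)))          ≡⟨ Σₚ-*ˡ (χ n) (λ s → χ s * χ (s + c)) ⟩
    χ n * Σₚ (λ s → χ s * χ (s + c))            ≡⟨ cong (χ n *_) (Σₚ-χχ-shift c≉0) ⟩
    χ n * -1ℤ                                   ≡⟨ solve 1 (λ k → k :* con -1ℤ := :- k) refl (χ n) ⟩
    - χ n                                       ∎
    where
    F : ℤ → ℤ
    F s = χ (n * s + m)

    F-periodic : Periodic F
    F-periodic s≈t = χ-cong (+-congʳ m (*-congˡ n s≈t))

    c : ℤ
    c = m * inv n

    c≉0 : c ≉ 0ℤ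
    c≉0 = *-≉0 m≉0 λ n⁻¹≈0 → 1≉0 (≈-trans (≈-sym (*-inv n≉0))
            (≈-trans (*-congˡ n n⁻¹≈0) (≈-reflexive (ℤ.*-zeroʳ n))))

    factor : ∀ s → χ s * F s ≡ χ n * (χ s * χ (s + c))
    factor s = begin
      χ s * χ (n * s + m)           ≡⟨ cong (χ s *_) (χ-cong (multiple (- m) (*-inv n≉0)
                                         (solve 4 (λ n s m i → n :* s :+ m :- n :* (s :+ m :* i) :=
                                           (:- m) :* (n :* i :- con 1ℤ)) refl n s m (inv n)))) ⟩
      χ s * χ (n * (s + c))         ≡⟨ cong (χ s *_) (χ-* n (s + c)) ⟩
      χ s * (χ n * χ (s + c))
        ≡⟨ solve 3 (λ a b c → a :* (b :* c) := b :* (a :* c)) refl (χ s) (χ n) (χ (s + c)) ⟩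
      χ n * (χ s * χ (s + c))       ∎

-- Counting the solutions of x³ - x = y³ - y.

module Family (p : ℕ) (p-prime : Prime p) (p>3 : p > 3) where

  open OddPrime p p-prime (ℕ.<-trans (ℕ.n<1+n 2) p>3) public
  open Residues p public

  3≉0 : + 3 ≉ 0ℤ
  3≉0 = pos≉0 3 p>3

  4≉0 : + 4 ≉ 0ℤ
  4≉0 = *-≉0 2≉0 2≉0

  -3≉0 : - + 3 ≉ 0ℤ
  -3≉0 = 3≉0 ∘ neg-cong

  -- Completing the square, 4 (x² + x y + y²) = (2 y + x)² + 3 x², and z = 2 y + x runs over Z/pZ
  -- with `y`. What remains is the number of square roots of 4 - 3 x².
  Σₚ-conic : ∀ x → Σₚ (λ y → δ (x ^ 2 + x * y + y ^ 2) 1ℤ) ≡ 1ℤ + χ (- + 3 * x ^ 2 + + 4)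
  Σₚ-conic x = begin
    Σₚ (λ y → δ (x ^ 2 + x * y + y ^ 2) 1ℤ)                 ≡⟨ Σₚ-cong (λ y → δ-⇔
        (λ q≈1 → multiple (+ 4) q≈1 (complete y))
        (λ eq → *-cancelˡ 4≉0 (multiple 1ℤ eq
          (trans (solve 2 (λ a b → con (+ 4) :* a :- con (+ 4) :* b := con (+ 4) :* (a :- b)) refl (x ^ 2 + x * y + y ^ 2) 1ℤ)
                 (trans (sym (complete y)) (sym (ℤ.*-identityˡ _))))))) ⟩
    Σₚ (λ y → δ ((+ 2 * y + x) ^ 2) (- + 3 * x ^ 2 + + 4))
      ≡⟨ Σₚ-affine (λ z → δ (z ^ 2) (- + 3 * x ^ 2 + + 4)) (λ y≈z → δ-cong (^-cong 2 y≈z) ≈-refl) (+ 2) (inv (+ 2)) x (*-inv 2≉0) ⟩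
    Σₚ (λ z → δ (z ^ 2) (- + 3 * x ^ 2 + + 4))              ≡⟨ Σₚ-roots _ ⟩
    1ℤ + χ (- + 3 * x ^ 2 + + 4)                            ∎
    where
    complete : ∀ y → (+ 2 * y + x) ^ 2 - (- + 3 * x ^ 2 + + 4) ≡ + 4 * (x ^ 2 + x * y + y ^ 2 - 1ℤ)
    complete = solve 2 (λ x y → (con (+ 2) :* y :+ x) :^ 2 :- (con (- + 3) :* x :^ 2 :+ con (+ 4)) :=
      con (+ 4) :* (x :^ 2 :+ x :* y :+ y :^ 2 :- con 1ℤ)) refl x

  -- Multiplying by 12 turns the equation into (6 x)² = 12, and 12 and 6 are invertible since p > 3.
  -- This is the source of the symbol of 12 in the final formula.
  Σₚ-3x²≈1 : Σₚ (λ x → δ (+ 3 * x ^ 2) 1ℤ) ≡ 1ℤ + χ (+ 12)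
  Σₚ-3x²≈1 = begin
    Σₚ (λ x → δ (+ 3 * x ^ 2) 1ℤ)         ≡⟨ Σₚ-cong (λ x → δ-⇔
        (λ eq → multiple (+ 12) eq (scaled x))
        (λ eq → *-cancelˡ (*-≉0 4≉0 3≉0) (multiple 1ℤ eq
          (trans (solve 2 (λ a b → con (+ 12) :* a :- con (+ 12) :* b := con (+ 12) :* (a :- b)) refl (+ 3 * x ^ 2) 1ℤ)
                 (trans (sym (scaled x)) (sym (ℤ.*-identityˡ _))))))) ⟩
    Σₚ (λ x → δ ((+ 6 * x) ^ 2) (+ 12))
      ≡⟨ Σₚ-scale (λ y → δ (y ^ 2) (+ 12)) (λ y≈z → δ-cong (^-cong 2 y≈z) ≈-refl) (*-≉0 2≉0 3≉0) ⟩
    Σₚ (λ y → δ (y ^ 2) (+ 12))           ≡⟨ Σₚ-roots (+ 12) ⟩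
    1ℤ + χ (+ 12)                         ∎
    where
    scaled : ∀ x → (+ 6 * x) ^ 2 - + 12 ≡ + 12 * (+ 3 * x ^ 2 - 1ℤ)
    scaled = solve 1 (λ x → (con (+ 6) :* x) :^ 2 :- con (+ 12) := con (+ 12) :* (con (+ 3) :* x :^ 2 :- con 1ℤ)) refl

  g : ℤ → ℤ
  g x = x ^ 3 - x

  g-cong : ∀ {x y} → x ≈ y → g x ≈ g y
  g-cong x≈y = minus-cong (^-cong 3 x≈y) x≈y

  -- g x − g y = (x − y)(x² + x y + y² − 1), and the two factors vanish together iff x = y and 3 x² = 1.
  δ-g : ∀ x y → δ (g x) (g y) ≡ δ y x + δ (x ^ 2 + x * y + y ^ 2) 1ℤ - δ y x * δ (+ 3 * x ^ 2) 1ℤ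
  δ-g x y with y ≈? x
  ... | yes y≈x = begin
    δ (g x) (g y)
      ≡⟨ δ-yes (g-cong (≈-sym y≈x)) ⟩
    1ℤ
      ≡⟨ solve 1 (λ d → con 1ℤ := con 1ℤ :+ d :- con 1ℤ :* d) refl (δ (+ 3 * x ^ 2) 1ℤ) ⟩
    1ℤ + δ (+ 3 * x ^ 2) 1ℤ - 1ℤ * δ (+ 3 * x ^ 2) 1ℤ
      ≡⟨ cong₂ (λ d e → d + e - d * δ (+ 3 * x ^ 2) 1ℤ) (δ-yes y≈x) (δ-cong (multiple (y + + 2 * x) y≈x
           (solve 2 (λ x y → x :^ 2 :+ x :* y :+ y :^ 2 :- con (+ 3) :* x :^ 2 := (y :+ con (+ 2) :* x) :* (y :- x)) refl x y)) ≈-refl) ⟨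
    δ y x + δ (x ^ 2 + x * y + y ^ 2) 1ℤ - δ y x * δ (+ 3 * x ^ 2) 1ℤ                ∎
  ... | no y≉x = begin
    δ (g x) (g y)                                                                    ≡⟨ δ-⇔
        (λ gx≈gy → *-cancelˡ x-y≉0 (multiple 1ℤ gx≈gy
          (solve 2 (λ x y → (x :- y) :* (x :^ 2 :+ x :* y :+ y :^ 2) :- (x :- y) :* con 1ℤ :=
            con 1ℤ :* (x :^ 3 :- x :- (y :^ 3 :- y))) refl x y)))
        (λ q≈1 → multiple (x - y) q≈1
          (solve 2 (λ x y → x :^ 3 :- x :- (y :^ 3 :- y) :=
            (x :- y) :* (x :^ 2 :+ x :* y :+ y :^ 2 :- con 1ℤ)) refl x y)) ⟩
    δ (x ^ 2 + x * y + y ^ 2) 1ℤ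
      ≡⟨ solve 2 (λ e d → e := con 0ℤ :+ e :- con 0ℤ :* d) refl _ (δ (+ 3 * x ^ 2) 1ℤ) ⟩
    0ℤ + δ (x ^ 2 + x * y + y ^ 2) 1ℤ - 0ℤ * δ (+ 3 * x ^ 2) 1ℤ
      ≡⟨ cong (λ d → d + δ (x ^ 2 + x * y + y ^ 2) 1ℤ - d * δ (+ 3 * x ^ 2) 1ℤ) (δ-no y≉x) ⟨
    δ y x + δ (x ^ 2 + x * y + y ^ 2) 1ℤ - δ y x * δ (+ 3 * x ^ 2) 1ℤ                ∎
    where
    x-y≉0 : x - y ≉ 0ℤ
    x-y≉0 x-y≈0 = y≉x (multiple -1ℤ x-y≈0 (solve 2 (λ x y → y :- x := con -1ℤ :* (x :- y :- con 0ℤ)) refl x y))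

  Σₚ-δ-g : Σₚ (λ x → Σₚ (λ y → δ (g x) (g y))) ≡ + p * + 2 - χ (- + 3) - (1ℤ + χ (+ 12))
  Σₚ-δ-g = begin
    Σₚ (λ x → Σₚ (λ y → δ (g x) (g y)))       ≡⟨ Σₚ-cong inner ⟩
    Σₚ (λ x → + 2 + C x - D x)                ≡⟨ Σₚ-∸ (λ x → + 2 + C x) D ⟩
    Σₚ (λ x → + 2 + C x) - Σₚ D               ≡⟨ cong (_- Σₚ D) (Σₚ-+ (λ _ → + 2) C) ⟩
    Σₚ (λ _ → + 2) + Σₚ C - Σₚ D
      ≡⟨ cong₂ _-_ (cong₂ _+_ (Σₚ-const (+ 2)) (Σₚ-χ-quadratic 4≉0 -3≉0)) Σₚ-3x²≈1 ⟩
    + p * + 2 - χ (- + 3) - (1ℤ + χ (+ 12))   ∎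
    where
    C D : ℤ → ℤ
    C x = χ (- + 3 * x ^ 2 + + 4)
    D x = δ (+ 3 * x ^ 2) 1ℤ

    -- The constant 2 collects the one point of the line x = y and the constant term of the conic
    -- count.
    inner : ∀ x → Σₚ (λ y → δ (g x) (g y)) ≡ + 2 + C x - D x
    inner x = begin
      Σₚ (λ y → δ (g x) (g y))                            ≡⟨ Σₚ-cong (δ-g x) ⟩
      Σₚ (λ y → δ y x + Q y - δ y x * D x)                ≡⟨ Σₚ-∸ (λ y → δ y x + Q y) (λ y → δ y x * D x) ⟩
      Σₚ (λ y → δ y x + Q y) - Σₚ (λ y → δ y x * D x)
        ≡⟨ cong₂ _-_ (trans (Σₚ-+ (λ y → δ y x) Q) (cong₂ _+_ (Σₚ-δ x) (Σₚ-conic x)))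
                     (Σₚ-δ* (λ _ → D x) (λ _ → refl) x) ⟩
      1ℤ + (1ℤ + C x) - D x                               ≡⟨ cong (_- D x) (sym (ℤ.+-assoc 1ℤ 1ℤ (C x))) ⟩
      + 2 + C x - D x                                     ∎
      where
      Q : ℤ → ℤ
      Q y = δ (x ^ 2 + x * y + y ^ 2) 1ℤ

  -- The second moments of `V` and of the family.

  V : ℤ → ℤ
  V t = Σₚ (λ x → χ (t + g x))

  Σₚ-V² : Σₚ (λ t → V t ^ 2) ≡ + p * (+ p * + 2 - χ (- + 3) - (1ℤ + χ (+ 12))) - + p * + p
  Σₚ-V² = begin
    Σₚ (λ t → V t ^ 2)
      -- `V t ^ 2` unfolds to `V t * (V t * 1ℤ)`, hence the identity law before the product of sums
      -- is expanded.
      ≡⟨ Σₚ-cong (λ t → trans (cong (V t *_) (ℤ.*-identityʳ (V t))) (Σₚ-* (λ x → χ (t + g x)) (λ y → χ (t + g y)))) ⟩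
    Σₚ (λ t → Σₚ (λ x → Σₚ (λ y → χ (t + g x) * χ (t + g y))))
      -- Two exchanges move the sum over `t` innermost, where the orthogonality relation `Σₚ-χχ`
      -- evaluates it.
      ≡⟨ Σₚ-comm (λ t x → Σₚ (λ y → χ (t + g x) * χ (t + g y))) ⟩
    Σₚ (λ x → Σₚ (λ t → Σₚ (λ y → χ (t + g x) * χ (t + g y))))
      ≡⟨ Σₚ-cong (λ x → Σₚ-comm (λ t y → χ (t + g x) * χ (t + g y))) ⟩
    Σₚ (λ x → Σₚ (λ y → Σₚ (λ t → χ (t + g x) * χ (t + g y))))
      ≡⟨ Σₚ-cong (λ x → Σₚ-cong (λ y → Σₚ-χχ (g x) (g y))) ⟩
    Σₚ (λ x → Σₚ (λ y → + p * δ (g x) (g y) - 1ℤ))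
      ≡⟨ Σₚ-cong (λ x → trans (Σₚ-∸ (λ y → + p * δ (g x) (g y)) (λ _ → 1ℤ))
           (cong₂ _-_ (Σₚ-*ˡ (+ p) (λ y → δ (g x) (g y))) (trans (Σₚ-const 1ℤ) (ℤ.*-identityʳ (+ p))))) ⟩
    Σₚ (λ x → + p * Σₚ (λ y → δ (g x) (g y)) - + p)
      ≡⟨ Σₚ-∸ (λ x → + p * Σₚ (λ y → δ (g x) (g y))) (λ _ → + p) ⟩
    Σₚ (λ x → + p * Σₚ (λ y → δ (g x) (g y))) - Σₚ (λ _ → + p)
      ≡⟨ cong₂ _-_ (trans (Σₚ-*ˡ (+ p) (λ x → Σₚ (λ y → δ (g x) (g y)))) (cong (+ p *_) Σₚ-δ-g)) (Σₚ-const (+ p)) ⟩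
    + p * (+ p * + 2 - χ (- + 3) - (1ℤ + χ (+ 12))) - + p * + p ∎

  T : ℤ → ℤ
  T t = Σₚ (λ x → χ (E t x))

  -- The curve degenerates to y² = x³, and `χ-³` reduces the sum to that of `χ`.
  T-zero : ∀ {t} → t ≈ 0ℤ → T t ≡ 0ℤ
  T-zero {t} t≈0 = begin
    Σₚ (λ x → χ (E t x))    ≡⟨ Σₚ-cong (λ x → trans
                                 (χ-cong (multiple (t ^ 3 - t * x) t≈0
                                   (solve 2 (λ t x → x :^ 3 :- t :^ 2 :* x :+ t :^ 4 :- x :^ 3 :=
                                     (t :^ 3 :- t :* x) :* (t :- con 0ℤ)) refl t x)))
                                 (χ-³ x)) ⟩
    Σₚ χ                    ≡⟨ Σₚ-χ ⟩
    0ℤ                      ∎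

  -- Replacing `x` by `t * x` turns the cubic into t³ (t + x³ - x). Grouping t³ as t² times t lets
  -- `χ-²*` strip the square and `χ-*` split off `χ t`.
  T-nonzero : ∀ {t} → t ≉ 0ℤ → T t ≡ χ t * V t
  T-nonzero {t} t≉0 = begin
    Σₚ (λ x → χ (E t x))                   ≡⟨ Σₚ-scale (λ x → χ (E t x))
                                                (λ x≈y → χ-cong (+-congʳ (t ^ 4) (minus-cong (^-cong 3 x≈y) (*-congˡ (t ^ 2) x≈y)))) t≉0 ⟨
    Σₚ (λ x → χ (E t (t * x)))             ≡⟨ Σₚ-cong (λ x → cong χ
                                                (solve 2 (λ t x → (t :* x) :^ 3 :- t :^ 2 :* (t :* x) :+ t :^ 4 :=
                                                  t :^ 2 :* (t :* (t :+ (x :^ 3 :- x)))) refl t x)) ⟩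
    Σₚ (λ x → χ (t ^ 2 * (t * (t + g x)))) ≡⟨ Σₚ-cong (λ x → trans (χ-²* t≉0 _) (χ-* t (t + g x))) ⟩
    Σₚ (λ x → χ t * χ (t + g x))           ≡⟨ Σₚ-*ˡ (χ t) (λ x → χ (t + g x)) ⟩
    χ t * V t                              ∎

  -- One formula for both cases: the factor `χ t * χ t`, equal to `1ℤ - δ t 0ℤ`, vanishes at the
  -- zero class exactly where `T` does. Summing over `t` then costs only the term at 0.
  T² : ∀ t → T t ^ 2 ≡ V t ^ 2 - δ t 0ℤ * V t ^ 2
  T² t with t ≈? 0ℤ
  ... | yes t≈0 = begin
    T t ^ 2                        ≡⟨ cong (_^ 2) (T-zero t≈0) ⟩
    0ℤ                             ≡⟨ solve 1 (λ v → con 0ℤ := v :- con 1ℤ :* v) refl (V t ^ 2) ⟩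
    V t ^ 2 - 1ℤ * V t ^ 2         ≡⟨ cong (λ d → V t ^ 2 - d * V t ^ 2) (δ-yes t≈0) ⟨
    V t ^ 2 - δ t 0ℤ * V t ^ 2     ∎
  ... | no t≉0 = begin
    T t ^ 2                        ≡⟨ cong (_^ 2) (T-nonzero t≉0) ⟩
    (χ t * V t) ^ 2                ≡⟨ solve 2 (λ c v → (c :* v) :^ 2 := (c :* c) :* v :^ 2) refl (χ t) (V t) ⟩
    χ t * χ t * V t ^ 2            ≡⟨ cong (_* V t ^ 2) (χ-square t) ⟩
    (1ℤ - δ t 0ℤ) * V t ^ 2
      ≡⟨ solve 2 (λ d v → (con 1ℤ :- d) :* v := v :- d :* v) refl (δ t 0ℤ) (V t ^ 2) ⟩
    V t ^ 2 - δ t 0ℤ * V t ^ 2     ∎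

  Σₚ-T² : Σₚ (λ t → T t ^ 2) ≡ Σₚ (λ t → V t ^ 2) - V 0ℤ ^ 2
  Σₚ-T² = begin
    Σₚ (λ t → T t ^ 2)                                        ≡⟨ Σₚ-cong T² ⟩
    Σₚ (λ t → V t ^ 2 - δ t 0ℤ * V t ^ 2)
      ≡⟨ Σₚ-∸ (λ t → V t ^ 2) (λ t → δ t 0ℤ * V t ^ 2) ⟩
    Σₚ (λ t → V t ^ 2) - Σₚ (λ t → δ t 0ℤ * V t ^ 2)
      ≡⟨ cong (_-_ (Σₚ (λ t → V t ^ 2))) (Σₚ-δ* (λ t → V t ^ 2) V²-periodic 0ℤ) ⟩
    Σₚ (λ t → V t ^ 2) - V 0ℤ ^ 2                             ∎
    where
    V²-periodic : Periodic (λ t → V t ^ 2)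
    V²-periodic s≈t = cong (_^ 2) (Σₚ-cong (λ x → χ-cong (+-congʳ (g x) s≈t)))

  V0² : V 0ℤ ^ 2 ≡ Σₚ (λ x → Σₚ (λ y → χ (g x) * χ (g y)))
  V0² = begin
    V 0ℤ ^ 2                                  ≡⟨ cong (_^ 2) (Σₚ-cong (λ x → cong χ (ℤ.+-identityˡ (g x)))) ⟩
    Σₚ (χ ∘ g) ^ 2                            ≡⟨ cong (Σₚ (χ ∘ g) *_) (ℤ.*-identityʳ (Σₚ (χ ∘ g))) ⟩
    Σₚ (χ ∘ g) * Σₚ (χ ∘ g)                   ≡⟨ Σₚ-* (χ ∘ g) (χ ∘ g) ⟩
    Σₚ (λ x → Σₚ (λ y → χ (g x) * χ (g y)))   ∎

  -- Translating the definitions of the statement into `δ`, `Σₚ` and `χ`.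

  opaque
    unfolding δ Σₚ χ

    -- `allFin p` is `tabulate id`, and `map′` preserves the truth value of `_≡?_[mod_]`; so once
    -- `δ` and `Σₚ` are unfolded, the general count of pairs has the required form.
    #points≡Σₚ : ∀ f → + #points f p ≡ Σₚ (λ x → Σₚ (λ y → δ (y ^ 2) (f x)))
    #points≡Σₚ f = length-filter-cartesianProduct
      (λ (x , y) → ⟦ y ⟧ ^ 2 ≡? f ⟦ x ⟧ [mod p ]) {p} {p} id id

    secondMoment≡Σₚ : ∀ f → secondMoment f p ≡ Σₚ (λ t → a f t p ^ 2)
    secondMoment≡Σₚ f = refl

    ∑∑-legendre≡Σₚ :
      ∑[ x < p ] (∑[ y < p ] (legendre (⟦ x ⟧ ^ 3 - ⟦ x ⟧) p * legendre (⟦ y ⟧ ^ 3 - ⟦ y ⟧) p)) ≡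
      Σₚ (λ x → Σₚ (λ y → χ (g x) * χ (g y)))
    ∑∑-legendre≡Σₚ = refl

  -- Above each `x` lie `1ℤ + χ (f t x)` points, and the ones add up to the `p` in the definition of
  -- `a`.
  a≡-Σₚ-χ : ∀ f t → a f t p ≡ - Σₚ (λ x → χ (f t x))
  a≡-Σₚ-χ f t = begin
    + p - + #points (f t) p                              ≡⟨ cong (_-_ (+ p)) (#points≡Σₚ (f t)) ⟩
    + p - Σₚ (λ x → Σₚ (λ y → δ (y ^ 2) (f t x)))
      ≡⟨ cong (_-_ (+ p)) (Σₚ-cong (λ x → Σₚ-roots (f t x))) ⟩
    + p - Σₚ (λ x → 1ℤ + χ (f t x))
      ≡⟨ cong (_-_ (+ p)) (trans (Σₚ-+ (λ _ → 1ℤ) (λ x → χ (f t x))) (cong (_+ Σₚ (λ x → χ (f t x))) (Σₚ-const 1ℤ))) ⟩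
    + p - (+ p * 1ℤ + Σₚ (λ x → χ (f t x)))
      ≡⟨ solve 2 (λ p s → p :- (p :* con 1ℤ :+ s) := :- s) refl (+ p) (Σₚ (λ x → χ (f t x))) ⟩
    - Σₚ (λ x → χ (f t x))                               ∎

lemma2p7 : ∀ (p : ℕ) → Prime p → p > 3 →
    secondMoment E p ≡
    (+ p) ^ 2 - + p - + p * legendre (- (+ 3)) p - + p * legendre (+ 12) p
    - ∑[ x < p ] (∑[ y < p ] (legendre (⟦ x ⟧ ^ 3 - ⟦ x ⟧) p * legendre (⟦ y ⟧ ^ 3 - ⟦ y ⟧) p))
lemma2p7 p p-prime p>3 = begin
  secondMoment E p                        ≡⟨ secondMoment≡Σₚ E ⟩
  Σₚ (λ t → a E t p ^ 2)
    ≡⟨ Σₚ-cong (λ t → trans (cong (_^ 2) (a≡-Σₚ-χ E t)) (solve 1 (λ z → (:- z) :^ 2 := z :^ 2) refl (T t))) ⟩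
  Σₚ (λ t → T t ^ 2)                      ≡⟨ Σₚ-T² ⟩
  Σₚ (λ t → V t ^ 2) - V 0ℤ ^ 2           ≡⟨ cong₂ _-_ Σₚ-V² V0² ⟩
  + p * (+ p * + 2 - χ (- + 3) - (1ℤ + χ (+ 12))) - + p * + p - W
    -- Expands p N - p² with N = 2 p - χ(-3) - (1 + χ(12)).
    ≡⟨ solve 4 (λ p c d w → p :* (p :* con (+ 2) :- c :- (con 1ℤ :+ d)) :- p :* p :- w :=
                            p :^ 2 :- p :- p :* c :- p :* d :- w) refl (+ p) (χ (- + 3)) (χ (+ 12)) W ⟩
  (+ p) ^ 2 - + p - + p * χ (- + 3) - + p * χ (+ 12) - W
    ≡⟨ cong₂ (λ c d → (+ p) ^ 2 - + p - + p * c - + p * d - W) (legendre≡χ (- + 3)) (legendre≡χ (+ 12)) ⟨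
  (+ p) ^ 2 - + p - + p * legendre (- + 3) p - + p * legendre (+ 12) p - W
    ≡⟨ cong (_-_ ((+ p) ^ 2 - + p - + p * legendre (- + 3) p - + p * legendre (+ 12) p)) ∑∑-legendre≡Σₚ ⟨
  _ ∎
  where
  open Family p p-prime p>3

  W : ℤ
  W = Σₚ (λ x → Σₚ (λ y → χ (g x) * χ (g y)))
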